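{- There is an absolute constant $K$ such that the following holds for every $n\ge 1$ and every integer $s\ge0$. If $f\colon S_n\to\{0,1\}$ has sensitivity $s$, then for every $\pi\in S_n$, $f$ can be recovered from its values on the ball of radius $Ks$ around $\pi$; that is, if $f,g\colon S_n\to\{0,1\}$ both have sensitivity $s$ and $f(\sigma)=g(\sigma)$ for all $\sigma$ in the ball of radius $Ks$ around $\pi$, then $f=g$.
   Context: The distance between two permutations $\pi,\sigma\in S_n$ is $|\{i\in[n]:\pi(i)\neq\sigma(i)\}|$; the ball of radius $r$ around $\pi$ is the set of all permutations at distance at most $r$ from $\pi$. The sensitivity of $f\colon S_n\to\{0,1\}$ at $\pi$, denoted $s(f,\pi)$, is the maximum number of pairwise disjoint transpositions $\tau_1,\dots,\tau_k\in S_n$ (no two of them move a common point) such that $f(\tau_j\pi)\neq f(\pi)$ for all $j$. The sensitivity of $f$ is $s(f)=\max_{\pi\in S_n}s(f,\pi)$. -}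

module Defs where

open import Level using (0ℓ)
open import Data.Bool.Base using (Bool)
open import Data.Nat.Base using (ℕ; _≤_)
open import Data.Fin.Base using (Fin)
open import Data.Fin.Properties using (_≟_)
open import Data.Fin.Permutation
  using (Permutation′; _⟨$⟩ʳ_; _≈_; _∘ₚ_; transpose)
open import Data.List.Base using (length; filter; allFin)
open import Data.Product.Base using (_×_; ∃; ∃₂)
open import Function.Bundles using (Func; _⟨$⟩_)
open import Relation.Binary.Bundles using (Setoid)
open import Relation.Binary.PropositionalEquality
  using (_≡_; _≢_; refl; sym; trans)
import Relation.Binary.PropositionalEquality.Properties as ≡
open import Relation.Nullary.Decidable.Core using (¬?)
open import Relation.Nullary.Negation.Core using (¬_)

-- Two inverse pairs with the same forward map need not be propositionally
-- equal, so the symmetric group is a setoid under pointwise equality.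
S : ℕ → Setoid 0ℓ 0ℓ
S n = record
  { Carrier       = Permutation′ n
  ; _≈_           = _≈_
  ; isEquivalence = record
    { refl  = λ _ → refl
    ; sym   = λ p i → sym (p i)
    ; trans = λ p q i → trans (p i) (q i)
    }
  }

BooleanFunction : ℕ → Set
BooleanFunction n = Func (S n) (≡.setoid Bool)

distance : ∀ {n} → Permutation′ n → Permutation′ n → ℕ
distance {n} π σ =
  length (filter (λ i → ¬? (π ⟨$⟩ʳ i ≟ σ ⟨$⟩ʳ i)) (allFin n))

Ball : ∀ {n} → Permutation′ n → ℕ → Permutation′ n → Set
Ball π r σ = distance π σ ≤ r

-- `transpose i i` is the identity, whence the condition i ≢ j.
IsTransposition : ∀ {n} → Permutation′ n → Set
IsTransposition τ = ∃₂ λ i j → i ≢ j × τ ≈ transpose i j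

Moves : ∀ {n} → Permutation′ n → Fin n → Set
Moves τ x = τ ⟨$⟩ʳ x ≢ x

Disjoint : ∀ {n} → Permutation′ n → Permutation′ n → Set
Disjoint τ τ′ = ∀ x → ¬ (Moves τ x × Moves τ′ x)

-- Library composition is diagrammatic: `π ∘ₚ τ j` is the product τⱼπ,
-- sending i to τⱼ(π(i)).
record SensitiveFamily {n} (f : BooleanFunction n) (π : Permutation′ n)
                       (k : ℕ) : Set where
  field
    τ             : Fin k → Permutation′ n
    transposition : ∀ j → IsTransposition (τ j)
    disjoint      : ∀ {i j} → i ≢ j → Disjoint (τ i) (τ j)
    sensitive     : ∀ j → f ⟨$⟩ (π ∘ₚ τ j) ≢ f ⟨$⟩ π

IsMaximum : (ℕ → Set) → ℕ → Set
IsMaximum P m = P m × (∀ k → P k → k ≤ m)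

-- The maxima s(f, π) and s(f) are given by their graphs: the relations
-- "s(f, π) = k" and "s(f) = s".
SensitivityAt : ∀ {n} → BooleanFunction n → Permutation′ n → ℕ → Set
SensitivityAt f π = IsMaximum (SensitiveFamily f π)

Sensitivity : ∀ {n} → BooleanFunction n → ℕ → Set
Sensitivity f = IsMaximum (λ k → ∃ λ π → SensitivityAt f π k)

{-# OPTIONS --safe #-}

-- Suppose f and g agree at all points closer to π than σ, but not at σ.  For
-- every i with σ(i) ≠ π(i) the transposition (σ(i) π(i)) moves σ closer to π,
-- so f or g is sensitive to it at σ.  Each of these transpositions meets at
-- most two others, so a third of them, chosen greedily, are pairwise disjoint;
-- at most s of the chosen ones are sensitive for f and at most s for g.  Hence
-- σ is at distance at most 3 · 2s from π, and K = 6 works.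
module Submission where

open import Level using (Level)
open import Data.Bool.Properties using () renaming (_≟_ to _≟ᵇ_)
open import Data.Nat.Base using (ℕ; _≥_; _*_; _+_; _∸_; _≤_; _<_; z≤n; s≤s)
open import Data.Nat.Properties
  using ( ≤-trans; ≤-reflexive; +-suc; +-mono-≤; *-monoˡ-≤; m≤n⇒m≤1+n; ≰⇒>; <⇒≱; <-trans; _≤?_
        ; ∸-monoʳ-<; module ≤-Reasoning)
open import Data.Nat.Induction using (<-wellFounded)
open import Data.Nat.Solver using (module +-*-Solver)
open import Data.Fin.Base using (Fin)
open import Data.Fin.Properties using (_≟_; injective⇒≤)
open import Data.Fin.Permutation
  using (Permutation′; _⟨$⟩ʳ_; _⟨$⟩ˡ_; _∘ₚ_; transpose; inverseˡ)
open import Data.List.Base using (List; []; _∷_; length; filter; allFin; map; concatMap; lookup)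
open import Data.List.Properties using (length-++; length-map)
open import Data.List.Membership.Propositional using (_∈_; _∉_)
open import Data.List.Membership.Propositional.Properties
  using (∈-lookup; ∈-filter⁺; ∈-filter⁻; ∈-allFin; ∈-++⁺ʳ; ∈-++⁺ˡ; ∈-concatMap⁺)
open import Data.List.Relation.Binary.Subset.Propositional using (_⊆_)
open import Data.List.Relation.Unary.All as All using (All; []; _∷_)
import Data.List.Relation.Unary.All.Properties as All
open import Data.List.Relation.Unary.AllPairs as AllPairs using (AllPairs; []; _∷_)
import Data.List.Relation.Unary.AllPairs.Properties as AllPairs
open import Data.List.Relation.Unary.Any as Any using (here; there)
open import Data.List.Relation.Unary.Any.Properties using (lookup-index)
open import Data.List.Relation.Unary.Unique.Propositional using (Unique)
import Data.List.Relation.Unary.Unique.Propositional.Properties as Unique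
open import Data.Product.Base using (∃; _×_; _,_; proj₁; proj₂; swap)
open import Data.Sum.Base using (_⊎_; inj₁; inj₂)
open import Data.Empty using (⊥)
open import Function.Base using (_∘_; _on_)
open import Function.Bundles using (_⟨$⟩_)
open import Induction.WellFounded using (Acc; acc)
open import Relation.Binary.Core using (Rel)
open import Relation.Binary.Definitions using (DecidableEquality; Symmetric)
open import Relation.Binary.PropositionalEquality
  using (_≡_; _≢_; refl; sym; trans; cong; subst; ≢-sym)
open import Relation.Nullary.Decidable using (yes; no; ¬?; _⊎-dec_; decidable-stable)
open import Relation.Nullary.Negation using (contradiction)
open import Relation.Unary using (Pred; Decidable)
open import Defs

private
  variable
    a p q ℓ : Level
    A : Set a
    n : ℕ

-- Lists

-- `AllPairs` relates earlier entries to later ones only; symmetry supplies the pairs with `i` after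
-- `j`.
AllPairs-lookup : {R : Rel A ℓ} → Symmetric R → ∀ {xs} → AllPairs R xs →
                  ∀ {i j} → i ≢ j → R (lookup xs i) (lookup xs j)
AllPairs-lookup sym-R (Rx ∷ Rxs) {Fin.zero}  {Fin.zero}  i≢j = contradiction refl i≢j
AllPairs-lookup sym-R (Rx ∷ Rxs) {Fin.zero}  {Fin.suc j} i≢j = All.lookup Rx (∈-lookup j)
AllPairs-lookup sym-R (Rx ∷ Rxs) {Fin.suc i} {Fin.zero}  i≢j = sym-R (All.lookup Rx (∈-lookup i))
AllPairs-lookup sym-R (Rx ∷ Rxs) {Fin.suc i} {Fin.suc j} i≢j =
  AllPairs-lookup sym-R Rxs (i≢j ∘ cong Fin.suc)

-- Sending each index of `xs` to a position of its entry in `ys` is injective: equal positions hold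
-- equal entries, and distinct indices of `xs` hold distinct ones.
Unique-⊆⇒length≤ : ∀ {xs ys : List A} → Unique xs → xs ⊆ ys → length xs ≤ length ys
Unique-⊆⇒length≤ {xs = xs} {ys} xs! xs⊆ys = injective⇒≤ {f = position} position-injective
  where
  position : Fin (length xs) → Fin (length ys)
  position i = Any.index (xs⊆ys (∈-lookup i))

  position-injective : ∀ {i j} → position i ≡ position j → i ≡ j
  position-injective {i} {j} eq = decidable-stable (i ≟ j) λ i≢j →
    AllPairs-lookup ≢-sym xs! i≢j
      (trans (lookup-index (xs⊆ys (∈-lookup i)))
        (trans (cong (lookup ys) eq) (sym (lookup-index (xs⊆ys (∈-lookup j))))))

length-filter-∪ : {P : Pred A p} {Q : Pred A q} (P? : Decidable P) (Q? : Decidable Q) →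
                  ∀ {xs} → All (λ x → P x ⊎ Q x) xs →
                  length xs ≤ length (filter P? xs) + length (filter Q? xs)
length-filter-∪ P? Q? [] = z≤n
length-filter-∪ P? Q? {x ∷ xs} (px ∷ pxs) with length-filter-∪ P? Q? pxs | P? x | Q? x
-- An entry satisfying both predicates is counted twice on the right, which leaves a slack of one.
... | ih | yes _  | yes _  = s≤s (≤-trans (m≤n⇒m≤1+n ih) (≤-reflexive (sym (+-suc _ _))))
... | ih | yes _  | no _   = s≤s ih
... | ih | no _   | yes _  = ≤-trans (s≤s ih) (≤-reflexive (sym (+-suc _ _)))
... | ih | no ¬Px | no ¬Qx with px
...   | inj₁ Px = contradiction Px ¬Px
...   | inj₂ Qx = contradiction Qx ¬Qx

length-concatMap-≤ : ∀ {b} {B : Set b} (N : A → List B) {c} → (∀ x → length (N x) ≤ c) →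
                     ∀ xs → length (concatMap N xs) ≤ length xs * c
length-concatMap-≤ N N≤c []       = z≤n
length-concatMap-≤ N N≤c (x ∷ xs) = ≤-trans (≤-reflexive (length-++ (N x)))
  (+-mono-≤ (N≤c x) (length-concatMap-≤ N N≤c xs))

-- The greedy maximal independent set of a graph with neighbourhoods N.
independent-cover : DecidableEquality A → (N : A → List A) → (∀ x → x ∈ N x) → ∀ xs →
                    ∃ λ ys → ys ⊆ xs × AllPairs (λ x y → x ∉ N y) ys × xs ⊆ concatMap N ys
independent-cover _≟A_ N refl-N []       = [] , (λ ()) , [] , λ ()
independent-cover _≟A_ N refl-N (x ∷ xs) with independent-cover _≟A_ N refl-N xs
... | ys , ys⊆xs , indep , cover with Any.any? (x ≟A_) (concatMap N ys)
...   | yes x∈ = ys , there ∘ ys⊆xs , indep , λ where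
          (here refl) → x∈
          (there z∈)  → cover z∈
...   | no x∉ = x ∷ ys
        , (λ where
             (here refl) → here refl
             (there y∈)  → there (ys⊆xs y∈))
        -- Being uncovered, `x` avoids `N y` for each chosen `y`. Nothing is known about `y` and
        -- `N x`, hence the one-sided form of independence.
        , All.tabulate (λ y∈ys x∈Ny → x∉ (∈-concatMap⁺ N (Any.map (λ { refl → x∈Ny }) y∈ys)))
            ∷ indep
        , λ where
            (here refl) → ∈-++⁺ˡ (refl-N x)
            (there z∈)  → ∈-++⁺ʳ (N x) (cover z∈)

-- Transpositions

transpose-left : ∀ (i j : Fin n) → transpose i j ⟨$⟩ʳ i ≡ j
transpose-left i j with i ≟ i
... | yes _  = refl
... | no i≢i = contradiction refl i≢i

transpose-fixes : ∀ {i j k : Fin n} → k ≢ i → k ≢ j → transpose i j ⟨$⟩ʳ k ≡ k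
transpose-fixes {i = i} {j} {k} k≢i k≢j with k ≟ i
... | yes k≡i = contradiction k≡i k≢i
... | no _ with k ≟ j
...   | yes k≡j = contradiction k≡j k≢j
...   | no _    = refl

transpose-moves : ∀ {i j k : Fin n} → Moves (transpose i j) k → k ≡ i ⊎ k ≡ j
transpose-moves {i = i} {j} {k} moved = decidable-stable ((k ≟ i) ⊎-dec (k ≟ j)) λ k∉ →
  moved (transpose-fixes (k∉ ∘ inj₁) (k∉ ∘ inj₂))

transpose-disjoint : ∀ {i j k l : Fin n} → i ≢ k → i ≢ l → j ≢ k → j ≢ l →
                     Disjoint (transpose i j) (transpose k l)
transpose-disjoint i≢k i≢l j≢k j≢l x (moved , moved′)
  with transpose-moves moved | transpose-moves moved′
... | inj₁ refl | inj₁ eq = i≢k eq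
... | inj₁ refl | inj₂ eq = i≢l eq
... | inj₂ refl | inj₁ eq = j≢k eq
... | inj₂ refl | inj₂ eq = j≢l eq

Disjoint-sym : Symmetric (Disjoint {n})
Disjoint-sym disj x = disj x ∘ swap

IsTransposition⇒Moves : ∀ {τ : Permutation′ n} → IsTransposition τ → ∃ (Moves τ)
IsTransposition⇒Moves (i , j , i≢j , τ≈) = i , λ fixed →
  i≢j (trans (sym fixed) (trans (τ≈ i) (transpose-left i j)))

-- Sensitivity

-- Picking one moved point from each member gives an injection into `Fin n`, because disjoint
-- members share no moved point.
SensitiveFamily⇒≤n : ∀ {f : BooleanFunction n} {π k} → SensitiveFamily f π k → k ≤ n
SensitiveFamily⇒≤n {n} {k = k} F = injective⇒≤ {f = proj₁ ∘ moved} moved-injective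
  where
  open SensitiveFamily F

  moved : ∀ j → ∃ (Moves (τ j))
  moved j = IsTransposition⇒Moves {τ = τ j} (transposition j)

  moved-injective : ∀ {i j} → proj₁ (moved i) ≡ proj₁ (moved j) → i ≡ j
  moved-injective {i} {j} eq = decidable-stable (i ≟ j) λ i≢j →
    disjoint i≢j _ (proj₂ (moved i) , subst (Moves (τ j)) (sym eq) (proj₂ (moved j)))

-- k ≤ s is stable under double negation, so the maximum s(f, π) need not be
-- computed: a family with more than s members is never of maximal size, and one
-- cannot keep enlarging it since all sizes are at most n.
SensitiveFamily⇒≤s : ∀ {f : BooleanFunction n} {s} → Sensitivity f s →
                     ∀ {π k} → SensitiveFamily f π k → k ≤ s
SensitiveFamily⇒≤s {n} {f} {s} (_ , bound) {π} {k} F =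
  decidable-stable (k ≤? s) λ k≰s → climb F (≰⇒> k≰s) (<-wellFounded _)
  where
  climb : ∀ {k} → SensitiveFamily f π k → s < k → Acc _<_ (n ∸ k) → ⊥
  climb {k} F s<k (acc rs) = contradiction (bound k (π , F , maximal)) (<⇒≱ s<k)
    where
    maximal : ∀ m → SensitiveFamily f π m → m ≤ k
    maximal m G = decidable-stable (m ≤? k) λ m≰k →
      -- The bound `m ≤ n` makes the truncated difference `n ∸ m` strictly smaller than `n ∸ k`.
      climb G (<-trans s<k (≰⇒> m≰k)) (rs (∸-monoʳ-< (≰⇒> m≰k) (SensitiveFamily⇒≤n G)))

SensitiveTo : BooleanFunction n → Permutation′ n → Permutation′ n → Set
SensitiveTo f π τ = f ⟨$⟩ (π ∘ₚ τ) ≢ f ⟨$⟩ π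

sensitiveTo? : ∀ (f : BooleanFunction n) π → Decidable (SensitiveTo f π)
sensitiveTo? f π τ = ¬? (f ⟨$⟩ (π ∘ₚ τ) ≟ᵇ f ⟨$⟩ π)

-- The transpositions that survive the filter, indexed by position, form a sensitive family at `π`.
length-sensitive≤s : ∀ {f : BooleanFunction n} {s} → Sensitivity f s → ∀ π {τs} →
                     All IsTransposition τs → AllPairs Disjoint τs →
                     length (filter (sensitiveTo? f π) τs) ≤ s
length-sensitive≤s {f = f} Sf π {τs} trs disj = SensitiveFamily⇒≤s Sf {π} record
  { τ             = lookup sensitives
  ; transposition = λ j → All.lookup (All.filter⁺ (sensitiveTo? f π) trs) (∈-lookup j)
  ; disjoint      = AllPairs-lookup (λ {x} {y} → Disjoint-sym {x = x} {y})
                      (AllPairs.filter⁺ (sensitiveTo? f π) disj)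
  ; sensitive     = λ j → All.lookup (All.all-filter (sensitiveTo? f π) τs) (∈-lookup j)
  }
  where sensitives = filter (sensitiveTo? f π) τs

-- Corrections of σ towards π

⟨$⟩ʳ-injective : ∀ (π : Permutation′ n) {i j} → π ⟨$⟩ʳ i ≡ π ⟨$⟩ʳ j → i ≡ j
⟨$⟩ʳ-injective π eq = trans (sym (inverseˡ π)) (trans (cong (π ⟨$⟩ˡ_) eq) (inverseˡ π))

module _ (π σ : Permutation′ n) where

  differs? : Decidable (λ i → π ⟨$⟩ʳ i ≢ σ ⟨$⟩ʳ i)
  differs? i = ¬? (π ⟨$⟩ʳ i ≟ σ ⟨$⟩ʳ i)

  differences : List (Fin n)
  differences = filter differs? (allFin n)

  differences-unique : Unique differences
  differences-unique = Unique.filter⁺ differs? (Unique.allFin⁺ n)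

  ∈-differences⁺ : ∀ {i} → π ⟨$⟩ʳ i ≢ σ ⟨$⟩ʳ i → i ∈ differences
  ∈-differences⁺ = ∈-filter⁺ differs? (∈-allFin _)

  ∈-differences⁻ : ∀ {i} → i ∈ differences → π ⟨$⟩ʳ i ≢ σ ⟨$⟩ʳ i
  ∈-differences⁻ = proj₂ ∘ ∈-filter⁻ differs? {xs = allFin n}

  -- It acts on values, after `σ`, so that `σ ∘ₚ correction i` takes the value of `π` at `i`.
  correction : Fin n → Permutation′ n
  correction i = transpose (σ ⟨$⟩ʳ i) (π ⟨$⟩ʳ i)

  -- If the correction at `k` shares a point with the one at `i`, then `k` is listed here: a common
  -- value of `σ`, or of `π`, forces `k ≡ i`, and the two mixed coincidences give the other entries.
  clashes : Fin n → List (Fin n)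
  clashes i = i ∷ (σ ⟨$⟩ˡ (π ⟨$⟩ʳ i)) ∷ (π ⟨$⟩ˡ (σ ⟨$⟩ʳ i)) ∷ []

  correction-disjoint : ∀ {i j} → i ∉ clashes j → Disjoint (correction i) (correction j)
  correction-disjoint {i} {j} i∉ = transpose-disjoint
    (i∉ ∘ here ∘ ⟨$⟩ʳ-injective σ)
    (λ eq → i∉ (there (here (trans (sym (inverseˡ σ)) (cong (σ ⟨$⟩ˡ_) eq)))))
    (λ eq → i∉ (there (there (here (trans (sym (inverseˡ π)) (cong (π ⟨$⟩ˡ_) eq))))))
    (i∉ ∘ here ∘ ⟨$⟩ʳ-injective π)

  -- The greedy choice covers all differences by the clashes of the chosen indices, and each chosen
  -- index accounts for at most three of them.
  disjoint-corrections : ∃ λ is → is ⊆ differences ×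
                         AllPairs (Disjoint on correction) is × distance π σ ≤ length is * 3
  disjoint-corrections =
    let is , is⊆ , indep , cover = independent-cover _≟_ clashes (λ _ → here refl) differences
    in is , is⊆ , AllPairs.map correction-disjoint indep
     , ≤-trans (Unique-⊆⇒length≤ differences-unique cover)
               (length-concatMap-≤ clashes (λ _ → ≤-reflexive refl) is)

-- The differences that remain, with `i` put in front, form a duplicate-free list inside the old
-- differences.
correction-closer : ∀ (π σ : Permutation′ n) {i} → π ⟨$⟩ʳ i ≢ σ ⟨$⟩ʳ i →
                    distance π (σ ∘ₚ correction π σ i) < distance π σ
correction-closer π σ {i} πi≢σi =
  Unique-⊆⇒length≤ (All.tabulate i-new ∷ differences-unique π σ′) λ where
    (here refl) → ∈-differences⁺ π σ πi≢σi
    (there k∈)  → ∈-differences⁺ π σ (still-differs (∈-differences⁻ π σ′ k∈))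
  where
  σ′ = σ ∘ₚ correction π σ i

  i-new : ∀ {k} → k ∈ differences π σ′ → i ≢ k
  i-new k∈ refl = ∈-differences⁻ π σ′ k∈ (sym (transpose-left (σ ⟨$⟩ʳ i) (π ⟨$⟩ʳ i)))

  still-differs : ∀ {k} → π ⟨$⟩ʳ k ≢ σ′ ⟨$⟩ʳ k → π ⟨$⟩ʳ k ≢ σ ⟨$⟩ʳ k
  -- Where `σ` already agrees with `π`, the correction changes nothing: its two points are values of
  -- `σ` and of `π` at `i`, and `k ≢ i`.
  still-differs {k} πk≢σ′k πk≡σk = πk≢σ′k (trans πk≡σk (sym (transpose-fixes
    (λ σk≡σi → k≢i (⟨$⟩ʳ-injective σ σk≡σi))
    (λ σk≡πi → k≢i (⟨$⟩ʳ-injective π (trans πk≡σk σk≡πi))))))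
    where
    k≢i : k ≢ i
    k≢i refl = πi≢σi πk≡σk

-- Induction on the distance to `π`

disagreement-close : ∀ {s} (f g : BooleanFunction n) → Sensitivity f s → Sensitivity g s →
                     ∀ π σ → (∀ ρ → distance π ρ < distance π σ → f ⟨$⟩ ρ ≡ g ⟨$⟩ ρ) →
                     f ⟨$⟩ σ ≢ g ⟨$⟩ σ → distance π σ ≤ 6 * s
disagreement-close {s = s} f g Sf Sg π σ agree-closer fσ≢gσ
  with is , is⊆ , disj , dist≤ ← disjoint-corrections π σ = begin
    distance π σ                            ≤⟨ dist≤ ⟩
    length is * 3                           ≡⟨ cong (_* 3) (sym (length-map (correction π σ) is)) ⟩
    length τs * 3                           ≤⟨ *-monoˡ-≤ 3 (length-filter-∪ (sensitiveTo? f σ)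
                                                 (sensitiveTo? g σ) either-sensitive) ⟩
    (length (filter (sensitiveTo? f σ) τs)
      + length (filter (sensitiveTo? g σ) τs)) * 3
                                            ≤⟨ *-monoˡ-≤ 3 (+-mono-≤
                                                 (length-sensitive≤s Sf σ transpositions τs-disjoint)
                                                 (length-sensitive≤s Sg σ transpositions τs-disjoint)) ⟩
    (s + s) * 3                             ≡⟨ solve 1 (λ x → (x :+ x) :* con 3 := con 6 :* x) refl s ⟩
    6 * s                                   ∎
  where
  open ≤-Reasoning
  open +-*-Solver

  τs = map (correction π σ) is

  transpositions : All IsTransposition τs
  transpositions = All.map⁺ (All.tabulate λ i∈ →
    _ , _ , ≢-sym (∈-differences⁻ π σ (is⊆ i∈)) , λ _ → refl)

  τs-disjoint : AllPairs Disjoint τs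
  τs-disjoint = AllPairs.map⁺ disj

  sensitive : ∀ {i} → i ∈ is →
              SensitiveTo f σ (correction π σ i) ⊎ SensitiveTo g σ (correction π σ i)
  sensitive {i} i∈ with f ⟨$⟩ (σ ∘ₚ correction π σ i) ≟ᵇ f ⟨$⟩ σ
  ... | no f-sensitive = inj₁ f-sensitive
  -- If `g` were unchanged as well, agreement at the closer corrected point would carry back to `σ`.
  ... | yes f-constant = inj₂ λ g-constant → fσ≢gσ (trans (sym f-constant)
    (trans (agree-closer _ (correction-closer π σ (∈-differences⁻ π σ (is⊆ i∈)))) g-constant))

  either-sensitive : All (λ τ → SensitiveTo f σ τ ⊎ SensitiveTo g σ τ) τs
  either-sensitive = All.map⁺ (All.tabulate sensitive)

-- The induction hypothesis gives agreement at all points closer to `π`. A disagreement at `σ` would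
-- then place `σ` in the ball, where `f` and `g` agree.
ball-determines : ∀ {s} (f g : BooleanFunction n) → Sensitivity f s → Sensitivity g s →
                  ∀ π → (∀ σ → Ball π (6 * s) σ → f ⟨$⟩ σ ≡ g ⟨$⟩ σ) →
                  ∀ σ → Acc _<_ (distance π σ) → f ⟨$⟩ σ ≡ g ⟨$⟩ σ
ball-determines f g Sf Sg π agree-on-ball σ (acc rs) =
  decidable-stable (f ⟨$⟩ σ ≟ᵇ g ⟨$⟩ σ) λ fσ≢gσ →
    fσ≢gσ (agree-on-ball σ (disagreement-close f g Sf Sg π σ
      (λ ρ closer → ball-determines f g Sf Sg π agree-on-ball ρ (rs closer)) fσ≢gσ))

theorem1p2 : ∃ λ (K : ℕ) →
    ∀ (n : ℕ) → n ≥ 1 →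
    ∀ (s : ℕ) (f g : BooleanFunction n) →
    Sensitivity f s → Sensitivity g s →
    ∀ (π : Permutation′ n) →
    (∀ (σ : Permutation′ n) → Ball π (K * s) σ → f ⟨$⟩ σ ≡ g ⟨$⟩ σ) →
    ∀ (σ : Permutation′ n) → f ⟨$⟩ σ ≡ g ⟨$⟩ σ
theorem1p2 = 6 , λ n _ s f g Sf Sg π agree-on-ball σ →
  ball-determines f g Sf Sg π agree-on-ball σ (<-wellFounded _)
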